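{- Let $k\ge 2$ be an integer and let $\theta\in(0,2\sqrt{k-1})$. Let $t_1\ge 4$ and $t_2\ge 3$ be the integers with $\lambda^{(t_1-3)}<\theta\le\lambda^{(t_1-2)}$ and $r^{(t_2-2)}<\theta\le r^{(t_2-1)}$, and put $c_1=-F_{t_1-2}(\theta)/G_{t_1-4}(\theta)$ and $c_2=-F_{t_2-1}(\theta)/\mathcal{G}_{t_2-2}(\theta)$. Then $$M(k,t_1,c_1)\le N(k,t_2,c_2).$$ Equality holds only if, for some integer $t$, $t_1=t_2=t+1$, $\theta=\lambda^{(t-1)}$, $c_1=1$, and $c_2=k$.
   Context: For the integer $k\ge 2$ define polynomials $F_i(x)$ by $F_0(x)=1$, $F_1(x)=x$, $F_2(x)=x^2-k$, and $F_i(x)=xF_{i-1}(x)-(k-1)F_{i-2}(x)$ for $i\ge 3$. Put $G_i(x)=\sum_{j=0}^{\lfloor i/2\rfloor}F_{i-2j}(x)$ and $\mathcal{G}_j(x)=\sum_{i=0}^{j}F_i(x)$. For $j\ge 1$, $\lambda^{(j)}$ is the largest zero of $G_j(x)$ and $r^{(j)}$ is the largest zero of $\mathcal{G}_j(x)$. One has $\bigcup_{j\ge1}(\lambda^{(j)},\lambda^{(j+1)}]=(0,2\sqrt{k-1})$ and $\bigcup_{j\ge1}(r^{(j)},r^{(j+1)}]=(-1,2\sqrt{k-1})$ (disjoint unions), so $t_1$ and $t_2$ exist and are unique. For integer $t\ge 4$ and real $c>0$, $$M(k,t,c)=2\left(\sum_{i=0}^{t-4}(k-1)^i+\frac{(k-1)^{t-3}}{c}+\frac{(k-1)^{t-2}}{c}\right),$$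 and for integer $t\ge 3$ and real $c>0$, $$N(k,t,c)=1+\sum_{i=0}^{t-3}k(k-1)^i+\frac{k(k-1)^{t-2}}{c}.$$ -}

module Defs where

open import Level using (0ℓ; suc)
open import Algebra.Bundles using (CommutativeRing; Semiring)
import Algebra.Definitions.RawSemiring as RawSemiringDefinitions
open import Data.Fin.Base using (toℕ)
open import Data.Nat.Base as ℕ using (ℕ; ⌊_/2⌋)
open import Data.Product.Base using (∃; _×_)
open import Relation.Binary.Core using (Rel)
open import Relation.Binary.Structures using (IsStrictTotalOrder)
import Relation.Binary.Construct.StrictToNonStrict as StrictToNonStrict
open import Relation.Nullary.Negation.Core using (¬_)

-- The classical real numbers, given by their usual axioms: a totally ordered
-- field in which every inhabited predicate that is bounded above has a least
-- upper bound.  Classically these axioms determine ℝ up to isomorphism.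
-- The order is trichotomous and hence decidable, so Bishop's constructive
-- reals are a model only in the presence of classical axioms.

record RealNumbers : Set (suc 0ℓ) where
  field
    commutativeRing : CommutativeRing 0ℓ 0ℓ

  open CommutativeRing commutativeRing public
    renaming (Carrier to ℝ)

  infix 4 _<_
  infix 8 _⁻¹

  field
    _<_                : Rel ℝ 0ℓ
    isStrictTotalOrder : IsStrictTotalOrder _≈_ _<_
    +-monoʳ-<          : ∀ z {x y} → x < y → z + x < z + y
    *-pos              : ∀ {x y} → 0# < x → 0# < y → 0# < x * y
    1≉0                : ¬ (1# ≈ 0#)

    -- Total, as is common for formalised fields; the value at 0# is
    -- left unspecified.
    _⁻¹                : ℝ → ℝ
    ⁻¹-cong            : ∀ {x y} → x ≈ y → x ⁻¹ ≈ y ⁻¹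
    *-inverseʳ         : ∀ x → ¬ (x ≈ 0#) → x * x ⁻¹ ≈ 1#

  open StrictToNonStrict _≈_ _<_ public using (_≤_)

  IsUpperBound : (ℝ → Set) → ℝ → Set
  IsUpperBound P b = ∀ x → P x → x ≤ b

  IsSupremum : (ℝ → Set) → ℝ → Set
  IsSupremum P s = IsUpperBound P s × (∀ b → IsUpperBound P b → s ≤ b)

  field
    supremum : (P : ℝ → Set) → ∃ P → ∃ (IsUpperBound P) → ∃ (IsSupremum P)

  infixl 7 _/_
  _/_ : ℝ → ℝ → ℝ
  x / y = x * y ⁻¹

  -- n ⋆ x is the n-fold sum x + … + x.
  open RawSemiringDefinitions (Semiring.rawSemiring semiring) public
    using (_^_; sum)
    renaming (_×_ to _⋆_)

  fromℕ : ℕ → ℝ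
  fromℕ n = n ⋆ 1#

  IsSquareRoot : ℝ → ℝ → Set
  IsSquareRoot a s = 0# ≤ s × s * s ≈ a

  IsLargestZero : (ℝ → ℝ) → ℝ → Set
  IsLargestZero f z = f z ≈ 0# × (∀ x → f x ≈ 0# → x ≤ z)

-- Polynomials are represented by the functions ℝ → ℝ they define.  An index
-- set {0, …, n} is rendered as Fin (suc n).

module Polynomials (R : RealNumbers) (k : ℕ) where
  open RealNumbers R

  private
    K : ℝ
    K = fromℕ k

    K-1 : ℝ
    K-1 = fromℕ k - 1#

  F : ℕ → ℝ → ℝ
  F 0 x = 1#
  F 1 x = x
  F 2 x = x ^ 2 - K
  F (ℕ.suc (ℕ.suc (ℕ.suc i))) x =
    x * F (ℕ.suc (ℕ.suc i)) x - K-1 * F (ℕ.suc i) x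

  G : ℕ → ℝ → ℝ
  G i x = sum {ℕ.suc ⌊ i /2⌋} λ j → F (i ℕ.∸ 2 ℕ.* toℕ j) x

  𝒢 : ℕ → ℝ → ℝ
  𝒢 j x = sum {ℕ.suc j} λ i → F (toℕ i) x

  -- Meaningful for 4 ≤ t and 0# < c only.
  M : ℕ → ℝ → ℝ
  M t c = fromℕ 2 *
    (sum {ℕ.suc (t ℕ.∸ 4)} (λ i → K-1 ^ toℕ i)
      + K-1 ^ (t ℕ.∸ 3) / c
      + K-1 ^ (t ℕ.∸ 2) / c)

  -- Meaningful for 3 ≤ t and 0# < c only.
  N : ℕ → ℝ → ℝ
  N t c =
    1# + sum {ℕ.suc (t ℕ.∸ 3)} (λ i → K * K-1 ^ toℕ i)
      + K * K-1 ^ (t ℕ.∸ 2) / c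

{-# OPTIONS --safe #-}
module Submission where

-- The polynomials G i and 𝒢 j satisfy P (n+2) = x P (n+1) - (k-1) P n with P 0 = 1
-- and P 1 = x or x + 1.  Positivity of a discrete Wronskian shows that, once
-- P 0, …, P n are positive at a point, they stay positive to its right; with the
-- intermediate value theorem the largest zeros increase with the index, and so
-- the hypotheses on θ become the sign conditions P (t-1) > 0 ≥ P t (and positivity
-- of all earlier terms) at θ for both sequences.  As 𝒢 j = G j + G (j-1), this
-- forces t₂ = t₁ - 1 or t₂ = t₁.
--
-- Put x = θ, m = t₁ - 4, g = G m, a = G (m+1) and b = - G (m+2) = (k-1) g - x a ≥ 0.
-- Up to positive factors, N - M is (k - x) a when t₂ = t₁ - 1, and
-- b (k - x) ((2k + x) a - k b) when t₂ = t₁, where 𝒢 (m+2) = a - b > 0.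
-- Both are nonnegative because x < 2√(k-1) ≤ k, and zero only if b = 0.

open import Defs
open import Data.Nat.Base as ℕ using (ℕ; zero; suc; _∸_; ⌊_/2⌋; z≤n; s≤s)
import Data.Nat.Properties as ℕₚ
open import Data.Fin.Base using (toℕ)
open import Data.Integer.Base as ℤ using (ℤ; +_; -[1+_])
import Data.Integer.Properties as ℤₚ
import Data.Sign.Base as Sign
open import Data.Maybe.Base as Maybe using (Maybe)
open import Data.Product.Base using (∃-syntax; _×_; _,_; proj₁; proj₂)
open import Data.Sum.Base using (_⊎_; inj₁; inj₂)
open import Data.Empty using (⊥-elim)
open import Relation.Nullary.Negation.Core using (¬_)
open import Relation.Nullary.Decidable.Core using (yes; no; dec⇒maybe)
open import Relation.Binary.Definitions using (tri<; tri≈; tri>)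
open import Relation.Binary.Structures using (IsStrictTotalOrder)
import Relation.Binary.Reasoning.Setoid as SetoidReasoning
open import Relation.Binary.PropositionalEquality.Core as ≡ using (_≡_)
open import Algebra.Bundles using (CommutativeRing)
import Algebra.Solver.Ring
import Algebra.Properties.Ring
import Algebra.Properties.AbelianGroup
import Algebra.Properties.Semiring.Mult.TCOptimised
import Algebra.Properties.Semiring.Sum
open import Algebra.Solver.Ring.AlmostCommutativeRing
  using (fromCommutativeRing; _-Raw-AlmostCommutative⟶_)

-- A ring solver with integer coefficients.

module IntegerCoefficientSolver {c ℓ} (A : CommutativeRing c ℓ) where
  open CommutativeRing A hiding (zero)
  open Algebra.Properties.Ring ring
    using (-0#≈0#; -‿distribˡ-*; -‿distribʳ-*)
    renaming (-‿involutive to ⁻¹-involutive)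
  open Algebra.Properties.AbelianGroup +-abelianGroup using (⁻¹-∙-comm)
  open Algebra.Properties.Semiring.Mult.TCOptimised semiring using (×1-homo-*; ×-homo-+; 1+×)
    renaming (_×_ to _⋆_)
  open SetoidReasoning setoid

  -- The optimised `_⋆_` sends 1 to `1#` with no trailing `0#`, so `con (+ 1)` denotes `1#`
  -- definitionally.
  ⟦_⟧ℤ : ℤ → Carrier
  ⟦ + n ⟧ℤ      = n ⋆ 1#
  ⟦ -[1+ n ] ⟧ℤ = - (suc n ⋆ 1#)

  ⊖-homo : ∀ m n → ⟦ m ℤ.⊖ n ⟧ℤ ≈ m ⋆ 1# - n ⋆ 1#
  ⊖-homo zero    zero    = sym (-‿inverseʳ 0#)
  ⊖-homo zero    (suc n) = sym (+-identityˡ _)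
  ⊖-homo (suc m) zero    = sym (trans (+-congˡ -0#≈0#) (+-identityʳ _))
  ⊖-homo (suc m) (suc n) = begin
    ⟦ suc m ℤ.⊖ suc n ⟧ℤ                    ≡⟨ ≡.cong ⟦_⟧ℤ (ℤₚ.[1+m]⊖[1+n]≡m⊖n m n) ⟩
    ⟦ m ℤ.⊖ n ⟧ℤ                            ≈⟨ ⊖-homo m n ⟩
    m ⋆ 1# - n ⋆ 1#                         ≈⟨ +-congʳ (+-identityʳ _) ⟨
    (m ⋆ 1# + 0#) - n ⋆ 1#                  ≈⟨ +-congʳ (+-congˡ (-‿inverseʳ 1#)) ⟨
    (m ⋆ 1# + (1# - 1#)) - n ⋆ 1#           ≈⟨ +-congʳ (+-assoc _ _ _) ⟨
    ((m ⋆ 1# + 1#) - 1#) - n ⋆ 1#           ≈⟨ +-congʳ (+-congʳ (+-comm _ _)) ⟩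
    ((1# + m ⋆ 1#) - 1#) - n ⋆ 1#           ≈⟨ +-assoc _ _ _ ⟩
    (1# + m ⋆ 1#) + (- 1# - n ⋆ 1#)         ≈⟨ +-congˡ (⁻¹-∙-comm _ _) ⟩
    (1# + m ⋆ 1#) - (1# + n ⋆ 1#)           ≈⟨ +-cong (1+× m 1#) (-‿cong (1+× n 1#)) ⟨
    suc m ⋆ 1# - suc n ⋆ 1#                 ∎

  -‿homo : ∀ i → ⟦ ℤ.- i ⟧ℤ ≈ - ⟦ i ⟧ℤ
  -‿homo (+ zero)  = sym -0#≈0#
  -‿homo (+ suc n) = refl
  -‿homo -[1+ n ]  = sym (⁻¹-involutive _)

  +-homo : ∀ i j → ⟦ i ℤ.+ j ⟧ℤ ≈ ⟦ i ⟧ℤ + ⟦ j ⟧ℤ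
  +-homo (+ m)    (+ n)    = ×-homo-+ 1# m n
  +-homo (+ m)    -[1+ n ] = ⊖-homo m (suc n)
  +-homo -[1+ m ] (+ n)    = trans (⊖-homo n (suc m)) (+-comm _ _)
  +-homo -[1+ m ] -[1+ n ] = begin
    - (suc (suc (m ℕ.+ n)) ⋆ 1#)      ≡⟨ ≡.cong (λ l → - (suc l ⋆ 1#)) (ℕₚ.+-suc m n) ⟨
    - ((suc m ℕ.+ suc n) ⋆ 1#)        ≈⟨ -‿cong (×-homo-+ 1# (suc m) (suc n)) ⟩
    - (suc m ⋆ 1# + suc n ⋆ 1#)       ≈⟨ ⁻¹-∙-comm _ _ ⟨
    - (suc m ⋆ 1#) - suc n ⋆ 1#       ∎

  -◃-homo : ∀ n → ⟦ Sign.- ℤ.◃ n ⟧ℤ ≈ - (n ⋆ 1#)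
  -◃-homo zero    = sym -0#≈0#
  -◃-homo (suc n) = refl

  +◃-homo : ∀ n → ⟦ Sign.+ ℤ.◃ n ⟧ℤ ≈ n ⋆ 1#
  +◃-homo zero    = refl
  +◃-homo (suc n) = refl

  *-homo : ∀ i j → ⟦ i ℤ.* j ⟧ℤ ≈ ⟦ i ⟧ℤ * ⟦ j ⟧ℤ
  *-homo (+ m)    (+ n)    = trans (+◃-homo (m ℕ.* n)) (×1-homo-* m n)
  *-homo (+ m)    -[1+ n ] = begin
    ⟦ Sign.- ℤ.◃ (m ℕ.* suc n) ⟧ℤ     ≈⟨ -◃-homo (m ℕ.* suc n) ⟩
    - ((m ℕ.* suc n) ⋆ 1#)            ≈⟨ -‿cong (×1-homo-* m (suc n)) ⟩
    - (m ⋆ 1# * suc n ⋆ 1#)           ≈⟨ -‿distribʳ-* _ _ ⟩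
    m ⋆ 1# * - (suc n ⋆ 1#)           ∎
  *-homo -[1+ m ] (+ n)    = begin
    ⟦ Sign.- ℤ.◃ (suc m ℕ.* n) ⟧ℤ     ≈⟨ -◃-homo (suc m ℕ.* n) ⟩
    - ((suc m ℕ.* n) ⋆ 1#)            ≈⟨ -‿cong (×1-homo-* (suc m) n) ⟩
    - (suc m ⋆ 1# * n ⋆ 1#)           ≈⟨ -‿distribˡ-* _ _ ⟩
    - (suc m ⋆ 1#) * n ⋆ 1#           ∎
  *-homo -[1+ m ] -[1+ n ] = begin
    (suc m ℕ.* suc n) ⋆ 1#               ≈⟨ ×1-homo-* (suc m) (suc n) ⟩
    suc m ⋆ 1# * suc n ⋆ 1#              ≈⟨ ⁻¹-involutive _ ⟨
    - - (suc m ⋆ 1# * suc n ⋆ 1#)        ≈⟨ -‿cong (-‿distribʳ-* _ _) ⟩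
    - (suc m ⋆ 1# * - (suc n ⋆ 1#))      ≈⟨ -‿distribˡ-* _ _ ⟩
    - (suc m ⋆ 1#) * - (suc n ⋆ 1#)      ∎

  ⟦⟧ℤ-morphism : ℤ.+-*-rawRing -Raw-AlmostCommutative⟶ fromCommutativeRing A
  ⟦⟧ℤ-morphism = record
    { ⟦_⟧ = ⟦_⟧ℤ ; +-homo = +-homo ; *-homo = *-homo ; -‿homo = -‿homo
    ; 0-homo = refl ; 1-homo = refl }

  ⟦_⟧ℤ≟⟦_⟧ℤ : ∀ i j → Maybe (⟦ i ⟧ℤ ≈ ⟦ j ⟧ℤ)
  ⟦ i ⟧ℤ≟⟦ j ⟧ℤ = Maybe.map (λ i≡j → reflexive (≡.cong ⟦_⟧ℤ i≡j)) (dec⇒maybe (i ℤₚ.≟ j))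

  open Algebra.Solver.Ring ℤ.+-*-rawRing (fromCommutativeRing A) ⟦⟧ℤ-morphism ⟦_⟧ℤ≟⟦_⟧ℤ public
    using (solve; _:=_; _:+_; _:*_; _:-_; :-_; con)

-- Ordered-field arithmetic, an intermediate value theorem, and two-sided bounds.

module RealProperties (R : RealNumbers) where
  open RealNumbers R hiding (zero)
  open IntegerCoefficientSolver commutativeRing public
    using (solve; _:=_; _:+_; _:*_; _:-_; :-_; con)
  open IsStrictTotalOrder isStrictTotalOrder public
    using (compare; <-respʳ-≈; <-respˡ-≈)
    renaming (trans to <-trans; irrefl to <-irrefl; asym to <-asym)

  x<y⇒0<y-x : ∀ {x y} → x < y → 0# < y - x
  x<y⇒0<y-x {x} {y} x<y =
    <-respʳ-≈ (+-comm (- x) y) (<-respˡ-≈ (-‿inverseˡ x) (+-monoʳ-< (- x) x<y))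

  -- Reduces an inequality to a visibly positive `z` and a ring identity for the difference; `≤-by`
  -- is the weak version.
  <-by : ∀ {x y z} → 0# < z → z ≈ y - x → x < y
  <-by {x} {y} {z} 0<z z≈y-x = <-respˡ-≈ (+-identityʳ x) (<-respʳ-≈ eq (+-monoʳ-< x 0<z))
    where
    eq : x + z ≈ y
    eq = trans (+-congˡ z≈y-x) (solve 2 (λ x y → x :+ (y :- x) := y) refl x y)

  x≤y⇒0≤y-x : ∀ {x y} → x ≤ y → 0# ≤ y - x
  x≤y⇒0≤y-x (inj₁ x<y) = inj₁ (x<y⇒0<y-x x<y)
  x≤y⇒0≤y-x (inj₂ x≈y) = inj₂ (sym (trans (+-congˡ (-‿cong x≈y)) (-‿inverseʳ _)))

  ≤-by : ∀ {x y z} → 0# ≤ z → z ≈ y - x → x ≤ y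
  ≤-by (inj₁ 0<z) eq = inj₁ (<-by 0<z eq)
  ≤-by {x} {y} {z} (inj₂ 0≈z) eq = inj₂ (begin
    x             ≈⟨ +-identityʳ x ⟨
    x + 0#        ≈⟨ +-congˡ (trans 0≈z eq) ⟩
    x + (y - x)   ≈⟨ solve 2 (λ x y → x :+ (y :- x) := y) refl x y ⟩
    y             ∎)
    where open SetoidReasoning setoid

  <⇒≱ : ∀ {x y} → x < y → ¬ y ≤ x
  <⇒≱ x<y (inj₁ y<x) = <-asym x<y y<x
  <⇒≱ x<y (inj₂ y≈x) = <-irrefl (sym y≈x) x<y

  <-or-≥ : ∀ x y → x < y ⊎ y ≤ x
  <-or-≥ x y with compare x y
  ... | tri< x<y _ _ = inj₁ x<y
  ... | tri≈ _ x≈y _ = inj₂ (inj₂ (sym x≈y))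
  ... | tri> _ _ y<x = inj₂ (inj₁ y<x)

  ≤-resp-≈ʳ : ∀ {x y z} → y ≈ z → x ≤ y → x ≤ z
  ≤-resp-≈ʳ y≈z (inj₁ x<y) = inj₁ (<-respʳ-≈ y≈z x<y)
  ≤-resp-≈ʳ y≈z (inj₂ x≈y) = inj₂ (trans x≈y y≈z)

  <-≤-trans : ∀ {x y z} → x < y → y ≤ z → x < z
  <-≤-trans x<y (inj₁ y<z) = <-trans x<y y<z
  <-≤-trans x<y (inj₂ y≈z) = <-respʳ-≈ y≈z x<y

  ≤-<-trans : ∀ {x y z} → x ≤ y → y < z → x < z
  ≤-<-trans (inj₁ x<y) y<z = <-trans x<y y<z
  ≤-<-trans (inj₂ x≈y) y<z = <-respˡ-≈ (sym x≈y) y<z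

  ≤-trans : ∀ {x y z} → x ≤ y → y ≤ z → x ≤ z
  ≤-trans x≤y (inj₁ y<z) = inj₁ (≤-<-trans x≤y y<z)
  ≤-trans x≤y (inj₂ y≈z) = ≤-resp-≈ʳ y≈z x≤y

  pos⇒≉0 : ∀ {x} → 0# < x → ¬ x ≈ 0#
  pos⇒≉0 0<x x≈0 = <-irrefl (sym x≈0) 0<x

  +-pos-nonneg : ∀ {x y} → 0# < x → 0# ≤ y → 0# < x + y
  +-pos-nonneg {x} {y} 0<x 0≤y =
    <-≤-trans 0<x (≤-by 0≤y (solve 2 (λ x y → y := x :+ y :- x) refl x y))

  +-pos : ∀ {x y} → 0# < x → 0# < y → 0# < x + y
  +-pos 0<x 0<y = +-pos-nonneg 0<x (inj₁ 0<y)

  +-nonneg : ∀ {x y} → 0# ≤ x → 0# ≤ y → 0# ≤ x + y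
  +-nonneg (inj₁ 0<x) 0≤y = inj₁ (+-pos-nonneg 0<x 0≤y)
  +-nonneg (inj₂ 0≈x) 0≤y = ≤-resp-≈ʳ (trans (sym (+-identityˡ _)) (+-congʳ 0≈x)) 0≤y

  *-nonneg : ∀ {x y} → 0# ≤ x → 0# ≤ y → 0# ≤ x * y
  *-nonneg (inj₁ 0<x) (inj₁ 0<y) = inj₁ (*-pos 0<x 0<y)
  *-nonneg (inj₁ 0<x) (inj₂ 0≈y) = inj₂ (sym (trans (*-congˡ (sym 0≈y)) (zeroʳ _)))
  *-nonneg (inj₂ 0≈x) _          = inj₂ (sym (trans (*-congʳ (sym 0≈x)) (zeroˡ _)))

  square-nonneg : ∀ x → 0# ≤ x * x
  square-nonneg x with compare 0# x
  ... | tri< 0<x _ _ = inj₁ (*-pos 0<x 0<x)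
  ... | tri≈ _ 0≈x _ = *-nonneg (inj₂ 0≈x) (inj₂ 0≈x)
  ... | tri> _ _ x<0 = inj₁ (<-respʳ-≈
    (solve 1 (λ x → (con (+ 0) :- x) :* (con (+ 0) :- x) := x :* x) refl x)
    (*-pos (x<y⇒0<y-x x<0) (x<y⇒0<y-x x<0)))

  0<1 : 0# < 1#
  0<1 with square-nonneg 1#
  ... | inj₁ 0<1*1 = <-respʳ-≈ (*-identityˡ 1#) 0<1*1
  ... | inj₂ 0≈1*1 = ⊥-elim (1≉0 (sym (trans 0≈1*1 (*-identityˡ 1#))))

  fromℕ-nonneg : ∀ n → 0# ≤ fromℕ n
  fromℕ-nonneg zero    = inj₂ refl
  fromℕ-nonneg (suc n) = +-nonneg (inj₁ 0<1) (fromℕ-nonneg n)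

  -- For negative `x`, the positive numbers `x * y` and `(0# - x) * y` would add up to zero.
  -- Positive denominators are cleared this way.
  pos-*-cancelʳ : ∀ {x y} → 0# < y → 0# < x * y → 0# < x
  pos-*-cancelʳ {x} {y} 0<y 0<xy with compare 0# x
  ... | tri< 0<x _ _ = 0<x
  ... | tri≈ _ 0≈x _ = ⊥-elim (pos⇒≉0 0<xy (trans (*-congʳ (sym 0≈x)) (zeroˡ y)))
  ... | tri> _ _ x<0 = ⊥-elim (pos⇒≉0 (+-pos 0<xy (*-pos (x<y⇒0<y-x x<0) 0<y))
    (solve 2 (λ x y → x :* y :+ (con (+ 0) :- x) :* y := con (+ 0)) refl x y))

  nonneg-*-cancelʳ : ∀ {x y} → 0# < y → 0# ≤ x * y → 0# ≤ x
  nonneg-*-cancelʳ {x} {y} 0<y 0≤xy with compare 0# x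
  ... | tri< 0<x _ _ = inj₁ 0<x
  ... | tri≈ _ 0≈x _ = inj₂ 0≈x
  ... | tri> _ _ x<0 = ⊥-elim (pos⇒≉0 (+-pos-nonneg (*-pos (x<y⇒0<y-x x<0) 0<y) 0≤xy)
    (solve 2 (λ x y → (con (+ 0) :- x) :* y :+ x :* y := con (+ 0)) refl x y))

  /-*-cancel : ∀ x {y} → 0# < y → (x / y) * y ≈ x
  /-*-cancel x {y} 0<y = begin
    (x * y ⁻¹) * y  ≈⟨ solve 3 (λ x y z → (x :* z) :* y := x :* (y :* z)) refl x y (y ⁻¹) ⟩
    x * (y * y ⁻¹)  ≈⟨ *-congˡ (*-inverseʳ y (pos⇒≉0 0<y)) ⟩
    x * 1#          ≈⟨ *-identityʳ x ⟩
    x               ∎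
    where open SetoidReasoning setoid

  /-pos : ∀ {x y} → 0# < x → 0# < y → 0# < x / y
  /-pos {x} 0<x 0<y = pos-*-cancelʳ 0<y (<-respʳ-≈ (sym (/-*-cancel x 0<y)) 0<x)

  *-cancelʳ : ∀ {x y z} → 0# < z → x * z ≈ y * z → x ≈ y
  *-cancelʳ {x} {y} {z} 0<z xz≈yz = begin
    x               ≈⟨ undo x ⟨
    (x * z) * z ⁻¹  ≈⟨ *-congʳ xz≈yz ⟩
    (y * z) * z ⁻¹  ≈⟨ undo y ⟩
    y               ∎
    where
    open SetoidReasoning setoid
    undo : ∀ w → (w * z) * z ⁻¹ ≈ w
    undo w = trans (*-assoc w z (z ⁻¹))
      (trans (*-congˡ (*-inverseʳ z (pos⇒≉0 0<z))) (*-identityʳ w))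

  -- A one-sided slope bound takes the place of continuity. The zero is the supremum of the points
  -- of the interval where `f` is at most 0.
  ivt : (f : ℝ → ℝ) → (∀ {x y} → x ≈ y → f x ≈ f y) →
        ∀ {a b C} → 0# < C → a ≤ b →
        (∀ {x y} → a ≤ x → x ≤ y → y ≤ b → f y - f x ≤ C * (y - x)) →
        f a < 0# → 0# < f b →
        ∃[ z ] a ≤ z × z ≤ b × f z ≈ 0#
  ivt f f-cong {a} {b} {C} 0<C a≤b lipschitz fa<0 0<fb =
    s , a≤s , s≤b , fs≈0
    where
    S : ℝ → Set
    S x = a ≤ x × x ≤ b × f x ≤ 0#
    sup = supremum S (a , inj₂ refl , a≤b , inj₁ fa<0) (b , λ x x∈S → proj₁ (proj₂ x∈S))
    s = proj₁ sup
    a≤s : a ≤ s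
    a≤s = proj₁ (proj₂ sup) a (inj₂ refl , a≤b , inj₁ fa<0)
    s≤b : s ≤ b
    s≤b = proj₂ (proj₂ sup) b (λ x x∈S → proj₁ (proj₂ x∈S))

    fs≮0 : ¬ f s < 0#
    fs≮0 fs<0 with <-or-≥ (s + (0# - f s) / C) b
    ... | inj₁ s+h<b = <⇒≱ s<s+h (proj₁ (proj₂ sup) (s + h) s+h∈S)
      where
      h = (0# - f s) / C
      s<s+h : s < s + h
      s<s+h = <-by (/-pos (x<y⇒0<y-x fs<0) 0<C) (solve 2 (λ s h → h := s :+ h :- s) refl s h)
      s+h∈S : S (s + h)
      s+h∈S = ≤-trans a≤s (inj₁ s<s+h) , inj₁ s+h<b ,
        ≤-by (x≤y⇒0≤y-x (lipschitz a≤s (inj₁ s<s+h) (inj₁ s+h<b)))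
          (trans (solve 5 (λ C s h fs fsh → C :* (s :+ h :- s) :- (fsh :- fs)
                             := (h :* C) :- (fsh :- fs)) refl C s h (f s) (f (s + h)))
            (trans (+-congʳ (/-*-cancel (0# - f s) 0<C))
              (solve 2 (λ u v → (con (+ 0) :- u) :- (v :- u) := con (+ 0) :- v) refl
                 (f s) (f (s + h)))))
    ... | inj₂ b≤s+h = pos⇒≉0
        (+-pos-nonneg 0<fb (+-nonneg (x≤y⇒0≤y-x (lipschitz a≤s s≤b (inj₂ refl)))
          (*-nonneg (inj₁ 0<C) (x≤y⇒0≤y-x b≤s+h))))
        (trans (solve 6 (λ C s h fs fb b → fb :+ (C :* (b :- s) :- (fb :- fs) :+ C :* ((s :+ h) :- b))
                             := fs :+ h :* C) refl C s _ (f s) (f b) b)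
          (trans (+-congˡ (/-*-cancel (0# - f s) 0<C))
            (solve 1 (λ u → u :+ (con (+ 0) :- u) := con (+ 0)) refl (f s))))

    fs≯0 : ¬ 0# < f s
    -- Climbing from a value at most 0 up to `f s` takes a distance of at least `f s / C`, so
    -- `s - h` is already an upper bound of `S`.
    fs≯0 0<fs = <⇒≱ s-h<s (proj₂ (proj₂ sup) (s - h) s-h-bound)
      where
      h = f s / C
      s-h<s : s - h < s
      s-h<s = <-by (/-pos 0<fs 0<C) (solve 2 (λ s h → h := s :- (s :- h)) refl s h)
      s-h-bound : ∀ x → S x → x ≤ s - h
      s-h-bound x x∈S@(a≤x , x≤b , fx≤0) = ≤-by
        (nonneg-*-cancelʳ 0<C (≤-resp-≈ʳ
          (trans (solve 5 (λ C x s fs fx → C :* (s :- x) :- (fs :- fx) :+ (con (+ 0) :- fx)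
                                      := (s :- x) :* C :- fs) refl C x s (f s) (f x))
            (trans (+-congˡ (-‿cong (sym (/-*-cancel (f s) 0<C))))
              (solve 4 (λ C x s h → (s :- x) :* C :- h :* C := (s :- h :- x) :* C) refl C x s h)))
          (+-nonneg (x≤y⇒0≤y-x (lipschitz a≤x (proj₁ (proj₂ sup) x x∈S) s≤b))
                    (x≤y⇒0≤y-x fx≤0))))
        refl

    fs≈0 : f s ≈ 0#
    fs≈0 with compare (f s) 0#
    ... | tri< fs<0 _ _ = ⊥-elim (fs≮0 fs<0)
    ... | tri≈ _ fs≈0 _ = fs≈0
    ... | tri> _ _ 0<fs = ⊥-elim (fs≯0 0<fs)

  infix 4 _boundedBy_
  -- The absolute value of `x` is at most `c`, as two sign conditions that combine by ring
  -- identities.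
  _boundedBy_ : ℝ → ℝ → Set
  x boundedBy c = 0# ≤ c - x × 0# ≤ c + x

  boundedBy-resp-≈ : ∀ {c x y} → x ≈ y → x boundedBy c → y boundedBy c
  boundedBy-resp-≈ x≈y (lo , hi) =
    ≤-resp-≈ʳ (+-congˡ (-‿cong x≈y)) lo , ≤-resp-≈ʳ (+-congˡ x≈y) hi

  nonneg-boundedBy : ∀ {x} → 0# ≤ x → x boundedBy x
  nonneg-boundedBy {x} 0≤x = inj₂ (sym (-‿inverseʳ x)) , +-nonneg 0≤x 0≤x

  neg-boundedBy : ∀ {c x} → x boundedBy c → - x boundedBy c
  neg-boundedBy {c} {x} (lo , hi) =
    ≤-resp-≈ʳ (solve 2 (λ c x → c :+ x := c :- :- x) refl c x) hi , lo

  +-boundedBy : ∀ {c d x y} → x boundedBy c → y boundedBy d → x + y boundedBy c + d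
  +-boundedBy {c} {d} {x} {y} (lo , hi) (lo′ , hi′) =
    ≤-resp-≈ʳ (solve 4 (λ c d x y → (c :- x) :+ (d :- y) := (c :+ d) :- (x :+ y)) refl c d x y)
      (+-nonneg lo lo′) ,
    ≤-resp-≈ʳ (solve 4 (λ c d x y → (c :+ x) :+ (d :+ y) := (c :+ d) :+ (x :+ y)) refl c d x y)
      (+-nonneg hi hi′)

  -- Twice `c * d - x * y` and twice `c * d + x * y` are sums of products of the four nonnegative
  -- quantities, so no case split on signs occurs.
  *-boundedBy : ∀ {c d x y} → x boundedBy c → y boundedBy d → x * y boundedBy c * d
  *-boundedBy {c} {d} {x} {y} (lo , hi) (lo′ , hi′) =
    nonneg-*-cancelʳ (+-pos 0<1 0<1) (≤-resp-≈ʳ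
      (solve 4 (λ c d x y → (c :- x) :* (d :+ y) :+ (c :+ x) :* (d :- y)
                              := (c :* d :- x :* y) :* (con (+ 2))) refl c d x y)
      (+-nonneg (*-nonneg lo hi′) (*-nonneg hi lo′))) ,
    nonneg-*-cancelʳ (+-pos 0<1 0<1) (≤-resp-≈ʳ
      (solve 4 (λ c d x y → (c :- x) :* (d :- y) :+ (c :+ x) :* (d :+ y)
                              := (c :* d :+ x :* y) :* (con (+ 2))) refl c d x y)
      (+-nonneg (*-nonneg lo lo′) (*-nonneg hi hi′)))

  boundedBy⇒nonneg : ∀ {c x} → x boundedBy c → 0# ≤ c
  boundedBy⇒nonneg {c} {x} (lo , hi) = nonneg-*-cancelʳ (+-pos 0<1 0<1)
    (≤-resp-≈ʳ (solve 2 (λ c x → (c :- x) :+ (c :+ x) := c :* con (+ 2)) refl c x)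
      (+-nonneg lo hi))

-- Sequences with a three-term recurrence: positivity and divided differences.

module SturmSequence (R : RealNumbers) (q e : RealNumbers.ℝ R)
  (0<q : RealNumbers._<_ R (RealNumbers.0# R) q)
  (0≤e : RealNumbers._≤_ R (RealNumbers.0# R) e) where

  open RealNumbers R hiding (zero)
  open RealProperties R

  P : ℕ → ℝ → ℝ
  P 0             x = 1#
  P 1             x = x + e
  P (suc (suc n)) x = x * P (suc n) x - q * P n x

  P-cong : ∀ n {x y} → x ≈ y → P n x ≈ P n y
  P-cong 0             x≈y = refl
  P-cong 1             x≈y = +-congʳ x≈y
  P-cong (suc (suc n)) x≈y =
    +-cong (*-cong x≈y (P-cong (suc n) x≈y)) (-‿cong (*-congˡ (P-cong n x≈y)))

  AllPositive : ℕ → ℝ → Set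
  AllPositive zero    x = 0# < P 0 x
  AllPositive (suc n) x = AllPositive n x × 0# < P (suc n) x

  AllPositive⇒0<P : ∀ {n x i} → i ℕ.≤ n → AllPositive n x → 0# < P i x
  AllPositive⇒0<P {zero}  z≤n pos = pos
  AllPositive⇒0<P {suc n} {i = i} i≤1+n (pos , 0<Px) with i ℕₚ.≟ suc n
  ... | yes ≡.refl = 0<Px
  ... | no  i≢1+n  = AllPositive⇒0<P (ℕₚ.≤-pred (ℕₚ.≤∧≢⇒< i≤1+n i≢1+n)) pos

  0<P-last : ∀ n {x} → AllPositive n x → 0# < P n x
  0<P-last n = AllPositive⇒0<P {n} ℕₚ.≤-refl

  -- A discrete Wronskian: W (suc n) x y = (y - x) * P (suc n) x * P (suc n) y + q * W n x y.
  W : ℕ → ℝ → ℝ → ℝ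
  W n x y = P (suc n) y * P n x - P (suc n) x * P n y

  -- Adding `P (suc n) x * P n y` to `W n x y` leaves `P (suc n) y * P n x`. The weak sign of
  -- `P (suc n) x` admits a zero of `P (suc n)` as `x`.
  0<P-right : ∀ n {x y} → 0# < W n x y → 0# < P n x → 0# < P n y →
              0# ≤ P (suc n) x → 0# < P (suc n) y
  0<P-right n {x} {y} 0<W 0<Px 0<Py 0≤P⁺x = pos-*-cancelʳ 0<Px (<-respʳ-≈
    (solve 4 (λ a b c d → a :* b :- c :* d :+ c :* d := a :* b) refl
      (P (suc n) y) (P n x) (P (suc n) x) (P n y))
    (+-pos-nonneg 0<W (*-nonneg 0≤P⁺x (inj₁ 0<Py))))

  -- The two claims need each other: `W n x y` gives positivity of `P (suc n) y`, which makes both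
  -- terms in the recurrence for `W (suc n) x y` positive.
  AllPositive-right : ∀ n {x y} → x < y → AllPositive n x → AllPositive n y × 0# < W n x y
  AllPositive-right zero {x} {y} x<y _ = 0<1 , <-respʳ-≈
    (trans (solve 3 (λ x y e → y :- x := (y :+ e) :- (x :+ e)) refl x y e)
      (+-cong (sym (*-identityʳ _)) (-‿cong (sym (*-identityʳ _)))))
    (x<y⇒0<y-x x<y)
  AllPositive-right (suc n) {x} {y} x<y (pos , 0<P⁺x)
    with posʸ , 0<W ← AllPositive-right n x<y pos =
    (posʸ , 0<P⁺y) , <-respʳ-≈
      (solve 7 (λ q x y a b c d → (y :- x) :* (b :* a) :+ q :* (a :* d :- b :* c)
                 := (y :* a :- q :* c) :* b :- (x :* b :- q :* d) :* a)
        refl q x y (P (suc n) y) (P (suc n) x) (P n y) (P n x))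
      (+-pos (*-pos (x<y⇒0<y-x x<y) (*-pos 0<P⁺x 0<P⁺y)) (*-pos 0<q 0<W))
    where
    0<P⁺y = 0<P-right n 0<W (0<P-last n pos)
              (0<P-last n posʸ) (inj₁ 0<P⁺x)

  right-of-nonneg : ∀ n {x y} → x < y → AllPositive n x → 0# ≤ P (suc n) x →
                    AllPositive (suc n) y
  right-of-nonneg n x<y pos 0≤P⁺x with posʸ , 0<W ← AllPositive-right n x<y pos =
    posʸ , 0<P-right n 0<W (0<P-last n pos)
             (0<P-last n posʸ) 0≤P⁺x

  -- A point to the right of all zeros. As `B - 1#` is `q + e`, the increments at `B` satisfy
  -- `Δ (suc n) = q * Δ n + e * P (suc n) B`, which keeps them nonnegative.
  B : ℝ
  B = q + 1# + e

  0<B : 0# < B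
  0<B = +-pos-nonneg (+-pos 0<q 0<1) 0≤e

  -- At B the sequence is nondecreasing.
  AllPositive-B : ∀ n → AllPositive n B
  AllPositive-B n = proj₁ (go n)
    where
    go : ∀ n → AllPositive n B × 0# ≤ P (suc n) B - P n B
    go zero = 0<1 , ≤-resp-≈ʳ
      (solve 2 (λ q e → q :+ (e :+ e) := (q :+ con (+ 1) :+ e) :+ e :- con (+ 1)) refl q e)
      (+-nonneg (inj₁ 0<q) (+-nonneg 0≤e 0≤e))
    go (suc n) with pos , 0≤Δ ← go n = (pos , 0<P⁺) , ≤-resp-≈ʳ
      (solve 4 (λ q e a b → q :* (b :- a) :+ e :* b
          := (q :+ con (+ 1) :+ e) :* b :- q :* a :- b) refl
        q e (P n B) (P (suc n) B))
      (+-nonneg (*-nonneg (inj₁ 0<q) 0≤Δ) (*-nonneg 0≤e (inj₁ 0<P⁺)))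
      where
      0<P⁺ : 0# < P (suc n) B
      0<P⁺ = <-respʳ-≈ (solve 2 (λ a b → a :+ (b :- a) := b) refl (P n B) (P (suc n) B))
        (+-pos-nonneg (0<P-last n pos) 0≤Δ)

  P-boundedBy : ∀ n → ∃[ C ] (∀ {x} → x boundedBy B → P n x boundedBy C)
  P-boundedBy 0 = 1# , λ _ → nonneg-boundedBy (inj₁ 0<1)
  P-boundedBy 1 = B + e , λ x≤B → +-boundedBy x≤B (nonneg-boundedBy 0≤e)
  P-boundedBy (suc (suc n)) with C , P≤C ← P-boundedBy n | C⁺ , P⁺≤C⁺ ← P-boundedBy (suc n) =
    B * C⁺ + q * C , λ x≤B → +-boundedBy (*-boundedBy x≤B (P⁺≤C⁺ x≤B))
      (neg-boundedBy (*-boundedBy (nonneg-boundedBy (inj₁ 0<q)) (P≤C x≤B)))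

  -- The divided difference of `P n`, as a polynomial in `x` and `y`. A bound for it between `- B`
  -- and `B` is a slope bound for `P n`.
  D : ℕ → ℝ → ℝ → ℝ
  D 0             x y = 0#
  D 1             x y = 1#
  D (suc (suc n)) x y = P (suc n) y + x * D (suc n) x y - q * D n x y

  D-correct : ∀ n x y → P n y - P n x ≈ D n x y * (y - x)
  D-correct 0 x y = trans (-‿inverseʳ 1#) (sym (zeroˡ _))
  D-correct 1 x y =
    trans (solve 3 (λ x y e → (y :+ e) :- (x :+ e) := y :- x) refl x y e) (sym (*-identityˡ _))
  D-correct (suc (suc n)) x y = trans
    (solve 7 (λ q x y a b c d → (y :* a :- q :* c) :- (x :* b :- q :* d)
       := a :* (y :- x) :+ x :* (a :- b) :- q :* (c :- d))
      refl q x y (P (suc n) y) (P (suc n) x) (P n y) (P n x))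
    (trans (+-cong (+-congˡ (*-congˡ (D-correct (suc n) x y))) (-‿cong (*-congˡ (D-correct n x y))))
      (solve 6 (λ q x h a b c → a :* h :+ x :* (b :* h) :- q :* (c :* h)
          := (a :+ x :* b :- q :* c) :* h)
        refl q x (y - x) (P (suc n) y) (D (suc n) x y) (D n x y)))

  D-boundedBy : ∀ n → ∃[ C ] (∀ {x y} → x boundedBy B → y boundedBy B → D n x y boundedBy C)
  D-boundedBy 0 = 0# , λ _ _ → nonneg-boundedBy (inj₂ refl)
  D-boundedBy 1 = 1# , λ _ _ → nonneg-boundedBy (inj₁ 0<1)
  D-boundedBy (suc (suc n))
    with C , D≤C ← D-boundedBy n | C⁺ , D⁺≤C⁺ ← D-boundedBy (suc n) | A , P≤A ← P-boundedBy (suc n) =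
    A + B * C⁺ + q * C , λ x≤B y≤B → +-boundedBy
      (+-boundedBy (P≤A y≤B) (*-boundedBy x≤B (D⁺≤C⁺ x≤B y≤B)))
      (neg-boundedBy (*-boundedBy (nonneg-boundedBy (inj₁ 0<q)) (D≤C x≤B y≤B)))

  abstract
    -- `P n` is positive at `B`, and its divided difference is bounded between `a` and `B`.
    P-ivt : ∀ n {a} → a boundedBy B → P n a < 0# → ∃[ z ] a ≤ z × P n z ≈ 0#
    P-ivt n {a} a-bounded Pa<0
      with C , D≤C ← D-boundedBy n = proj₁ root , proj₁ (proj₂ root) , proj₂ (proj₂ (proj₂ root))
        where
        a≤B : a ≤ B
        a≤B = ≤-by (proj₁ a-bounded) refl
        bounded : ∀ {x} → a ≤ x → x ≤ B → x boundedBy B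
        bounded {x} a≤x x≤B = x≤y⇒0≤y-x x≤B , ≤-resp-≈ʳ
          (solve 3 (λ B a x → (B :+ a) :+ (x :- a) := B :+ x) refl B a x)
          (+-nonneg (proj₂ a-bounded) (x≤y⇒0≤y-x a≤x))
        -- `C` is only known to be nonnegative, while `ivt` asks for a positive constant; hence
        -- `1# + C`.
        lipschitz : ∀ {x y} → a ≤ x → x ≤ y → y ≤ B → P n y - P n x ≤ (1# + C) * (y - x)
        lipschitz {x} {y} a≤x x≤y y≤B = ≤-by
          (+-nonneg
            (*-nonneg (proj₁ (D≤C (bounded a≤x (≤-trans x≤y y≤B)) (bounded (≤-trans a≤x x≤y) y≤B)))
              (x≤y⇒0≤y-x x≤y))
            (*-nonneg (inj₁ 0<1) (x≤y⇒0≤y-x x≤y)))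
          (trans
            (solve 4 (λ i C h d → (C :- d) :* h :+ i :* h := (i :+ C) :* h :- d :* h)
              refl 1# C (y - x) (D n x y))
            (+-congˡ (-‿cong (sym (D-correct n x y)))))
        root : ∃[ z ] a ≤ z × z ≤ B × P n z ≈ 0#
        root = ivt (P n) (P-cong n)
          (+-pos-nonneg 0<1 (boundedBy⇒nonneg (D≤C a-bounded a-bounded)))
          a≤B lipschitz Pa<0 (0<P-last n (AllPositive-B n))

  -- Monotonicity of the largest zeros, and signs on either side of them.

  module LargestZeros (Z : ℕ → ℝ)
    (isLargestZero : ∀ j → 1 ℕ.≤ j → IsLargestZero (P j) (Z j)) where

    PZ≈0 : ∀ j → P (suc j) (Z (suc j)) ≈ 0#
    PZ≈0 j = proj₁ (isLargestZero (suc j) (s≤s z≤n))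

    Z₁-bounded : Z 1 boundedBy B
    Z₁-bounded = boundedBy-resp-≈ -e≈Z₁ (neg-boundedBy
      ( ≤-resp-≈ʳ (solve 3 (λ q i e → q :+ i := (q :+ i :+ e) :- e) refl q 1# e)
          (inj₁ (+-pos 0<q 0<1))
      , +-nonneg (inj₁ 0<B) 0≤e))
      where
      -e≈Z₁ : - e ≈ Z 1
      -e≈Z₁ = trans (sym (+-identityˡ _)) (trans (+-congʳ (sym (PZ≈0 0)))
        (solve 2 (λ z e → (z :+ e) :- e := z) refl (Z 1) e))

    -- At a zero of `P (suc j)` the recurrence leaves only `- (q * P j)`.
    P⁺Z<0 : ∀ j → AllPositive j (Z (suc j)) → P (suc (suc j)) (Z (suc j)) < 0#
    P⁺Z<0 j pos = <-by (*-pos 0<q (0<P-last j pos))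
      (trans (solve 3 (λ q z p → q :* p := con (+ 0) :- (z :* con (+ 0) :- q :* p)) refl
               q (Z (suc j)) (P j (Z (suc j))))
        (+-congˡ (-‿cong (+-congʳ (*-congˡ (sym (PZ≈0 j)))))))

    -- `P (suc (suc j))` is negative at `Z (suc j)`, hence has a zero to its right, and cannot
    -- itself vanish there.
    Z<Z⁺ : ∀ j → AllPositive j (Z (suc j)) → Z (suc j) boundedBy B → Z (suc j) < Z (suc (suc j))
    Z<Z⁺ j pos z-bounded with w , z≤w , Pw≈0 ← P-ivt (suc (suc j)) z-bounded (P⁺Z<0 j pos)
      with ≤-trans z≤w (proj₂ (isLargestZero (suc (suc j)) (s≤s z≤n)) w Pw≈0)
    ... | inj₁ z<z⁺ = z<z⁺
    ... | inj₂ z≈z⁺ = ⊥-elim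
      (<-irrefl (trans (P-cong (suc (suc j)) z≈z⁺) (PZ≈0 (suc j))) (P⁺Z<0 j pos))

    Z≤B : ∀ j → Z (suc j) ≤ B
    Z≤B j with <-or-≥ B (Z (suc j))
    ... | inj₂ z≤B = z≤B
    ... | inj₁ B<z = ⊥-elim (pos⇒≉0
      (0<P-last (suc j) (proj₁ (AllPositive-right (suc j) B<z (AllPositive-B (suc j))))) (PZ≈0 j))

    -- Positivity at one largest zero places the next one strictly to its right; `right-of-nonneg`
    -- then carries positivity over, with the new term starting from the value 0. The lower bound
    -- `- B` is inherited from the previous zero.
    AllPositive-Z : ∀ j → AllPositive j (Z (suc j)) × Z (suc j) boundedBy B
    AllPositive-Z zero = 0<1 , Z₁-bounded
    AllPositive-Z (suc j) with pos , z-bounded ← AllPositive-Z j =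
      right-of-nonneg j (Z<Z⁺ j pos z-bounded) pos (inj₂ (sym (PZ≈0 j))) ,
      (x≤y⇒0≤y-x (Z≤B (suc j)) , ≤-resp-≈ʳ
        (solve 3 (λ B z z⁺ → (B :+ z) :+ (z⁺ :- z) := B :+ z⁺) refl B (Z (suc j)) (Z (suc (suc j))))
        (+-nonneg (proj₂ z-bounded) (x≤y⇒0≤y-x (inj₁ (Z<Z⁺ j pos z-bounded)))))

    right-of-Z : ∀ j {x} → Z (suc j) < x → AllPositive (suc j) x
    right-of-Z j Z<x = right-of-nonneg j Z<x (proj₁ (AllPositive-Z j)) (inj₂ (sym (PZ≈0 j)))

    -- A nonnegative value at `x` would force a positive one at the zero `Z (suc j)` further right.
    left-of-Z : ∀ j {x} → AllPositive j x → x < Z (suc j) → P (suc j) x < 0#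
    left-of-Z j {x} pos x<Z with <-or-≥ (P (suc j) x) 0#
    ... | inj₁ Px<0 = Px<0
    ... | inj₂ 0≤Px = ⊥-elim (pos⇒≉0 (proj₂ (right-of-nonneg j x<Z pos 0≤Px)) (PZ≈0 j))

    P≤0-left-of-Z : ∀ j {x} → AllPositive j x → x ≤ Z (suc j) → P (suc j) x ≤ 0#
    P≤0-left-of-Z j pos (inj₁ x<Z) = inj₁ (left-of-Z j pos x<Z)
    P≤0-left-of-Z j pos (inj₂ x≈Z) = inj₂ (trans (P-cong (suc j) x≈Z) (PZ≈0 j))

-- Factorisations of the difference between the two bounds.

module Gap (R : RealNumbers) where
  open RealNumbers R hiding (zero)
  open RealProperties R

  -- M t₁ c₁ is lower K S p u and, for t₂ = t₁ - 1, N t₂ c₂ is upper K S p v,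
  -- where K = k, p = (k-1)^(t₁-3), S = 1 + ... + (k-1)^(t₁-4), u = 1/c₁ and
  -- v = 1/c₂.  For t₂ = t₁, N t₂ c₂ has S + p and (k-1) p in place of S and p.
  lower upper : ℝ → ℝ → ℝ → ℝ → ℝ
  lower K S p u = fromℕ 2 * (S + p * u + ((K - 1#) * p) * u)
  upper K S p v = (S + S + p) + (K * p) * v

  -- Here `c₁` and `c₂` share the numerator `D`, so one multiplication by `D` clears both
  -- reciprocals.
  gap-when-t₂≡t₁-1 : ∀ {K S p u v D g a x} →
    u * D ≈ g → v * D ≈ a + g → D ≈ K * g - x * a →
    (upper K S p v - lower K S p u) * D ≈ p * ((K - x) * a)
  gap-when-t₂≡t₁-1 {K} {S} {p} {u} {v} {D} {g} {a} {x} uD≈g vD≈a+g D≈ = begin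
    (upper K S p v - lower K S p u) * D
      ≈⟨ solve 6 (λ K S p u v D →
           ((S :+ S :+ p) :+ (K :* p) :* v
             -- This is the unfolded form of `fromℕ 2`.
             :- (con (+ 1) :+ (con (+ 1) :+ con (+ 0)))
                :* (S :+ p :* u :+ ((K :- con (+ 1)) :* p) :* u)) :* D
           := p :* D :+ (K :* p) :* (v :* D) :- con (+ 2) :* (K :* p :* (u :* D)))
         refl K S p u v D ⟩
    p * D + (K * p) * (v * D) - (1# + 1#) * (K * p * (u * D))
      ≈⟨ +-cong (+-cong (*-congˡ D≈) (*-congˡ vD≈a+g)) (-‿cong (*-congˡ (*-congˡ uD≈g))) ⟩
    p * (K * g - x * a) + (K * p) * (a + g) - (1# + 1#) * (K * p * g)
      ≈⟨ solve 5 (λ K p g a x →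
           p :* (K :* g :- x :* a) :+ (K :* p) :* (a :+ g) :- con (+ 2) :* (K :* p :* g)
           := p :* ((K :- x) :* a))
         refl K p g a x ⟩
    p * ((K - x) * a)  ∎
    where open SetoidReasoning setoid

  -- The numerators `D` of `c₁` and `E` of `c₂` now differ, so both are multiplied in. Eliminating
  -- `b` leaves a polynomial identity in `K`, `g`, `a` and `x`.
  gap-when-t₂≡t₁ : ∀ {K S p u v D E g a b x} →
    u * D ≈ g → v * E ≈ a - b →
    D ≈ K * g - x * a → E ≈ K * a + x * b → b ≈ (K - 1#) * g - x * a →
    (upper K (S + p) ((K - 1#) * p) v - lower K S p u) * (D * E)
      ≈ p * (b * ((K - x) * ((K + K + x) * a - K * b)))
  gap-when-t₂≡t₁ {K} {S} {p} {u} {v} {D} {E} {g} {a} {b} {x} uD≈g vE≈a-b D≈ E≈ b≈ = begin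
    (upper K (S + p) ((K - 1#) * p) v - lower K S p u) * (D * E)
      ≈⟨ solve 7 (λ K S p u v D E →
           (((S :+ p) :+ (S :+ p) :+ (K :- con (+ 1)) :* p) :+ (K :* ((K :- con (+ 1)) :* p)) :* v
             :- (con (+ 1) :+ (con (+ 1) :+ con (+ 0)))
                :* (S :+ p :* u :+ ((K :- con (+ 1)) :* p) :* u)) :* (D :* E)
           := p :* ((K :+ con (+ 1)) :* D :* E :+ (K :* K :- K) :* (v :* E) :* D
                    :- con (+ 2) :* K :* (u :* D) :* E))
         refl K S p u v D E ⟩
    p * ((K + 1#) * D * E + (K * K - K) * (v * E) * D - (1# + 1#) * K * (u * D) * E)
      ≈⟨ *-congˡ (+-cong
           (+-cong (*-cong (*-congˡ D≈) E≈e) (*-cong (*-congˡ vE≈) D≈))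
           (-‿cong (*-cong (*-congˡ uD≈g) E≈e))) ⟩
    p * ((K + 1#) * d * e + (K * K - K) * (a - b′) * d - (1# + 1#) * K * g * e)
      ≈⟨ *-congˡ (solve 4 (λ K g a x →
           let b = (K :- con (+ 1)) :* g :- x :* a
               d = K :* g :- x :* a
               e = K :* a :+ x :* b in
           (K :+ con (+ 1)) :* d :* e :+ (K :* K :- K) :* (a :- b) :* d :- con (+ 2) :* K :* g :* e
           := b :* ((K :- x) :* ((K :+ K :+ x) :* a :- K :* b)))
         refl K g a x) ⟩
    p * (b′ * ((K - x) * ((K + K + x) * a - K * b′)))
      ≈⟨ *-congˡ (*-cong b≈ (*-congˡ (+-congˡ (-‿cong (*-congˡ b≈))))) ⟨
    p * (b * ((K - x) * ((K + K + x) * a - K * b)))  ∎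
    where
    open SetoidReasoning setoid
    b′ = (K - 1#) * g - x * a
    d = K * g - x * a
    e = K * a + x * b′
    E≈e = trans E≈ (+-congˡ (*-congˡ b≈))
    vE≈ = trans vE≈a-b (+-congˡ (-‿cong b≈))

-- Expressing `F`, `G`, `𝒢` and the sum in `N` through the recurrences.

module PolynomialIdentities (R : RealNumbers) (k : ℕ) (2≤k : 2 ℕ.≤ k) where
  open RealNumbers R hiding (zero)
  open Polynomials R k
  open RealProperties R
  open Algebra.Properties.Semiring.Sum semiring using (sum-cong-≗)

  K q : ℝ
  K = fromℕ k
  q = K - 1#

  0<q : 0# < q
  0<q = fromℕ-1-pos 2≤k
    where
    fromℕ-1-pos : ∀ {n} → 2 ℕ.≤ n → 0# < fromℕ n - 1#
    fromℕ-1-pos {suc (suc n)} (s≤s (s≤s _)) = <-respʳ-≈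
      (solve 1 (λ l → con (+ 1) :+ l := (con (+ 1) :+ (con (+ 1) :+ l)) :- con (+ 1)) refl (fromℕ n))
      (+-pos-nonneg 0<1 (fromℕ-nonneg n))

  sum-snoc : ∀ n (f : ℕ → ℝ) →
             sum {suc n} (λ i → f (toℕ i)) ≈ sum {n} (λ i → f (toℕ i)) + f n
  sum-snoc zero    f = +-comm _ _
  sum-snoc (suc n) f = trans (+-congˡ (sum-snoc n (λ i → f (suc i)))) (sym (+-assoc _ _ _))

  powerSum : ℕ → ℝ
  powerSum n = sum {n} λ i → q ^ toℕ i

  -- As `K` is `q + 1#`, each term splits into two consecutive powers, and the leading `1#`
  -- completes the shifted geometric sum.
  1+sum-K*power : ∀ n → 1# + sum {n} (λ i → K * q ^ toℕ i) ≈ powerSum n + powerSum n + q ^ n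
  1+sum-K*power zero    = solve 0 (con (+ 1) :+ con (+ 0) := con (+ 0) :+ con (+ 0) :+ con (+ 1)) refl
  1+sum-K*power (suc n) = begin
    1# + sum {suc n} (λ i → K * q ^ toℕ i)
      ≈⟨ trans (+-congˡ (sum-snoc n (λ i → K * q ^ i))) (sym (+-assoc _ _ _)) ⟩
    (1# + sum {n} (λ i → K * q ^ toℕ i)) + K * q ^ n
      ≈⟨ +-congʳ (1+sum-K*power n) ⟩
    (powerSum n + powerSum n + q ^ n) + K * q ^ n
      ≈⟨ solve 3 (λ s p K → (s :+ s :+ p) :+ K :* p
                   := (s :+ p) :+ (s :+ p) :+ (K :- con (+ 1)) :* p) refl (powerSum n) (q ^ n) K ⟩
    (powerSum n + q ^ n) + (powerSum n + q ^ n) + q * q ^ n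
      ≈⟨ +-congʳ (+-cong (sum-snoc n (q ^_)) (sum-snoc n (q ^_))) ⟨
    powerSum (suc n) + powerSum (suc n) + q * q ^ n  ∎
    where open SetoidReasoning setoid

  module A = SturmSequence R q 0# 0<q (inj₂ refl)
  module B = SturmSequence R q 1# 0<q (inj₁ 0<1)

  -- The irregular constant `K` in `F 2` is `q + 1#`, whose extra `1#` is the subtracted `A.P 0`.
  -- From two initial cases the common linear recurrence takes over.
  F≈ : ∀ n x → F (suc (suc n)) x ≈ A.P (suc (suc n)) x - A.P n x
  F≈ 0 x = solve 2 (λ x K → x :* (x :* con (+ 1)) :- K
    := (x :* (x :+ con (+ 0)) :- (K :- con (+ 1)) :* con (+ 1)) :- con (+ 1)) refl x K
  F≈ 1 x = trans (+-congʳ (*-congˡ (F≈ 0 x)))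
    (solve 3 (λ x q a → x :* (a :- con (+ 1)) :- q :* x
      := (x :* a :- q :* (x :+ con (+ 0))) :- (x :+ con (+ 0))) refl x q (A.P 2 x))
  F≈ (suc (suc n)) x = trans
    (+-cong (*-congˡ (F≈ (suc n) x)) (-‿cong (*-congˡ (F≈ n x))))
    (solve 6 (λ x q a b c d → x :* (a :- b) :- q :* (c :- d)
      := (x :* a :- q :* c) :- (x :* b :- q :* d)) refl
      x q (A.P (3 ℕ.+ n) x) (A.P (suc n) x) (A.P (2 ℕ.+ n) x) (A.P n x))

  G≈ : ∀ n x → G n x ≈ A.P n x
  G≈ 0 x = +-identityʳ 1#
  G≈ 1 x = refl
  G≈ (suc (suc n)) x = begin
    F (suc (suc n)) x + sum {suc ⌊ n /2⌋} (λ j → F (suc (suc n) ∸ 2 ℕ.* suc (toℕ j)) x)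
      -- Rewriting `2 * suc j` as `2 + 2 * j` cancels the two successors, so the remaining terms are
      -- those of `G n`.
      ≡⟨ ≡.cong (λ s → F (suc (suc n)) x + s) (sum-cong-≗ {n = suc ⌊ n /2⌋} (λ j →
           ≡.cong (λ i → F (suc (suc n) ∸ i) x) (ℕₚ.*-suc 2 (toℕ j)))) ⟩
    F (suc (suc n)) x + G n x
      ≈⟨ +-cong (F≈ n x) (G≈ n x) ⟩
    (A.P (suc (suc n)) x - A.P n x) + A.P n x
      ≈⟨ solve 2 (λ a b → (a :- b) :+ b := a) refl (A.P (suc (suc n)) x) (A.P n x) ⟩
    A.P (suc (suc n)) x  ∎
    where open SetoidReasoning setoid

  -- Both sides satisfy the same linear recurrence, so agreement at the first two indices suffices.
  BP≈ : ∀ n x → B.P (suc n) x ≈ A.P (suc n) x + A.P n x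
  BP≈ 0 x = solve 1 (λ x → x :+ con (+ 1) := (x :+ con (+ 0)) :+ con (+ 1)) refl x
  BP≈ 1 x = trans (+-congʳ (*-congˡ (BP≈ 0 x)))
    (solve 2 (λ x q → x :* ((x :+ con (+ 0)) :+ con (+ 1)) :- q :* con (+ 1)
      := (x :* (x :+ con (+ 0)) :- q :* con (+ 1)) :+ (x :+ con (+ 0))) refl x q)
  BP≈ (suc (suc n)) x = trans
    (+-cong (*-congˡ (BP≈ (suc n) x)) (-‿cong (*-congˡ (BP≈ n x))))
    (solve 5 (λ x q a b c → x :* (a :+ b) :- q :* (b :+ c)
      := (x :* a :- q :* b) :+ (x :* b :- q :* c)) refl
      x q (A.P (2 ℕ.+ n) x) (A.P (suc n) x) (A.P n x))

  𝒢≈ : ∀ n x → 𝒢 n x ≈ B.P n x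
  𝒢≈ 0 x = +-identityʳ 1#
  𝒢≈ 1 x = solve 1 (λ x → con (+ 1) :+ (x :+ con (+ 0)) := x :+ con (+ 1)) refl x
  𝒢≈ (suc (suc n)) x = begin
    𝒢 (suc (suc n)) x
      ≈⟨ sum-snoc (suc (suc n)) (λ i → F i x) ⟩
    𝒢 (suc n) x + F (suc (suc n)) x
      ≈⟨ +-cong (trans (𝒢≈ (suc n) x) (BP≈ n x)) (F≈ n x) ⟩
    (A.P (suc n) x + A.P n x) + (A.P (suc (suc n)) x - A.P n x)
      ≈⟨ solve 3 (λ a b c → (a :+ b) :+ (c :- b) := c :+ a) refl
           (A.P (suc n) x) (A.P n x) (A.P (suc (suc n)) x) ⟩
    A.P (suc (suc n)) x + A.P (suc n) x
      ≈⟨ BP≈ (suc n) x ⟨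
    B.P (suc (suc n)) x  ∎
    where open SetoidReasoning setoid

  -F≈ : ∀ n x → - F (suc (suc n)) x ≈ K * A.P n x - x * A.P (suc n) x
  -F≈ n x = trans (-‿cong (F≈ n x))
    (solve 4 (λ x K a g → :- ((x :* a :- (K :- con (+ 1)) :* g) :- g) := K :* g :- x :* a) refl
      x K (A.P (suc n) x) (A.P n x))

-- Comparing the two bounds from the signs at `θ`.

module Comparison (R : RealNumbers) (k : ℕ) (2≤k : 2 ℕ.≤ k) where
  open RealNumbers R hiding (zero)
  open Polynomials R k
  open RealProperties R
  open Gap R
  open PolynomialIdentities R k 2≤k

  ^-pos : ∀ {x} n → 0# < x → 0# < x ^ n
  ^-pos zero    0<x = 0<1
  ^-pos (suc n) 0<x = *-pos 0<x (^-pos n 0<x)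

  -- Supplies the hypotheses on `u` and `v` in `Gap`, which are reciprocals of quotients.
  /-⁻¹-* : ∀ {x y} → 0# < x → 0# < y → (x / y) ⁻¹ * x ≈ y
  /-⁻¹-* {x} {y} 0<x 0<y = begin
    (x / y) ⁻¹ * x                ≈⟨ *-congˡ (/-*-cancel x 0<y) ⟨
    (x / y) ⁻¹ * ((x / y) * y)    ≈⟨ solve 3 (λ z w y → z :* (w :* y) := (w :* z) :* y) refl
                                       ((x / y) ⁻¹) (x / y) y ⟩
    ((x / y) * (x / y) ⁻¹) * y    ≈⟨ *-congʳ (*-inverseʳ _ (pos⇒≉0 (/-pos 0<x 0<y))) ⟩
    1# * y                        ≈⟨ *-identityˡ y ⟩
    y                             ∎
    where open SetoidReasoning setoid

  0<K : 0# < K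
  0<K = <-respʳ-≈ (solve 1 (λ K → (K :- con (+ 1)) :+ con (+ 1) := K) refl K) (+-pos 0<q 0<1)

  N≈upper : ∀ n c → N (3 ℕ.+ n) c ≈ upper K (powerSum (suc n)) (q ^ suc n) (c ⁻¹)
  N≈upper n c = +-congʳ (1+sum-K*power (suc n))

  module AtIndex (m : ℕ) {θ : ℝ} (0<θ : 0# < θ) (θ<K : θ < K)
    (0<g : 0# < A.P m θ) (0<a : 0# < A.P (suc m) θ) (-b≤0 : A.P (suc (suc m)) θ ≤ 0#) where

    -- `X` is the numerator of `c₁`, and of `c₂` when `t₂` is `t₁ - 1`; `Y` is the numerator of `c₂`
    -- when `t₂` is `t₁`.
    g a b X Y c₁ : ℝ
    g = A.P m θ
    a = A.P (suc m) θ
    b = - A.P (suc (suc m)) θ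
    X = - F (suc (suc m)) θ
    Y = - F (suc (suc (suc m))) θ
    c₁ = X / G m θ

    0≤b : 0# ≤ b
    0≤b = ≤-resp-≈ʳ (+-identityˡ b) (x≤y⇒0≤y-x -b≤0)

    b≈ : b ≈ q * g - θ * a
    b≈ = solve 4 (λ q g θ a → :- (θ :* a :- q :* g) := q :* g :- θ :* a) refl q g θ a

    X≈g+b : X ≈ g + b
    X≈g+b = trans (-‿cong (F≈ m θ))
      (solve 2 (λ g b → :- (b :- g) := g :+ (:- b)) refl g (A.P (suc (suc m)) θ))

    0<X : 0# < X
    0<X = <-respʳ-≈ (sym X≈g+b) (+-pos-nonneg 0<g 0≤b)

    Y≈ : Y ≈ K * a + θ * b
    Y≈ = trans (-F≈ (suc m) θ)
      (solve 4 (λ K a θ d → K :* a :- θ :* d := K :* a :+ θ :* :- d) refl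
        K a θ (A.P (suc (suc m)) θ))

    0<Y : 0# < Y
    0<Y = <-respʳ-≈ (sym Y≈) (+-pos-nonneg (*-pos 0<K 0<a) (*-nonneg (inj₁ 0<θ) 0≤b))

    0<G : 0# < G m θ
    0<G = <-respʳ-≈ (sym (G≈ m θ)) 0<g

    c₁⁻¹X≈g : c₁ ⁻¹ * X ≈ g
    c₁⁻¹X≈g = trans (/-⁻¹-* 0<X 0<G) (G≈ m θ)

    0<K-θ : 0# < K - θ
    0<K-θ = x<y⇒0<y-x θ<K

    -- All factors of the scaled gap are positive, so the case where `t₂` is `t₁ - 1` never yields
    -- equality.
    M<N : M (4 ℕ.+ m) c₁ < N (3 ℕ.+ m) (X / 𝒢 (suc m) θ)
    M<N = <-respʳ-≈ (sym (N≈upper m _)) (<-by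
      (pos-*-cancelʳ 0<X (<-respʳ-≈
        (sym (gap-when-t₂≡t₁-1 {S = powerSum (suc m)} c₁⁻¹X≈g c₂⁻¹X≈ (-F≈ m θ)))
        (*-pos (^-pos (suc m) 0<q) (*-pos 0<K-θ 0<a))))
      refl)
      where
      𝒢≈a+g : 𝒢 (suc m) θ ≈ a + g
      𝒢≈a+g = trans (𝒢≈ (suc m) θ) (BP≈ m θ)
      c₂⁻¹X≈ : (X / 𝒢 (suc m) θ) ⁻¹ * X ≈ a + g
      c₂⁻¹X≈ = trans (/-⁻¹-* 0<X (<-respʳ-≈ (sym 𝒢≈a+g) (+-pos 0<a 0<g))) 𝒢≈a+g

    -- The case where `t₂` equals `t₁`.

    module _ (0<BP : 0# < B.P (suc (suc m)) θ) where

      c₂ : ℝ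
      c₂ = Y / 𝒢 (suc (suc m)) θ

      𝒢≈a-b : 𝒢 (suc (suc m)) θ ≈ a - b
      𝒢≈a-b = trans (𝒢≈ (suc (suc m)) θ) (trans (BP≈ (suc m) θ)
        (solve 2 (λ d a → d :+ a := a :- :- d) refl (A.P (suc (suc m)) θ) a))

      0<𝒢 : 0# < 𝒢 (suc (suc m)) θ
      0<𝒢 = <-respʳ-≈ (sym (𝒢≈ (suc (suc m)) θ)) 0<BP

      c₂⁻¹Y≈a-b : c₂ ⁻¹ * Y ≈ a - b
      c₂⁻¹Y≈a-b = trans (/-⁻¹-* 0<Y 0<𝒢) 𝒢≈a-b

      N≈ : N (4 ℕ.+ m) c₂ ≈ upper K (powerSum (suc m) + q ^ suc m) (q * q ^ suc m) (c₂ ⁻¹)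
      N≈ = trans (N≈upper (suc m) c₂)
        (+-congʳ (+-congʳ (+-cong (sum-snoc (suc m) (q ^_)) (sum-snoc (suc m) (q ^_)))))

      slack : ℝ
      slack = (K - θ) * ((K + K + θ) * a - K * b)

      -- The second factor is `K * (a - b) + (K + θ) * a`, and `a - b` is the positive value of
      -- `𝒢 (suc (suc m))` at `θ`.
      0<slack : 0# < slack
      0<slack = *-pos 0<K-θ (<-respʳ-≈
        (solve 4 (λ K a b θ → K :* (a :- b) :+ (K :+ θ) :* a
                   := (K :+ K :+ θ) :* a :- K :* b) refl K a b θ)
        (+-pos (*-pos 0<K (<-respʳ-≈ 𝒢≈a-b 0<𝒢)) (*-pos (+-pos 0<K 0<θ) 0<a)))

      N-M-scaled : (N (4 ℕ.+ m) c₂ - M (4 ℕ.+ m) c₁) * (X * Y) ≈ q ^ suc m * (b * slack)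
      N-M-scaled = trans (*-congʳ (+-congʳ N≈))
        (gap-when-t₂≡t₁ {S = powerSum (suc m)} c₁⁻¹X≈g c₂⁻¹Y≈a-b (-F≈ m θ) Y≈ b≈)

      M≤N : M (4 ℕ.+ m) c₁ ≤ N (4 ℕ.+ m) c₂
      M≤N = ≤-by (nonneg-*-cancelʳ (*-pos 0<X 0<Y) (≤-resp-≈ʳ (sym N-M-scaled)
        (*-nonneg (inj₁ (^-pos (suc m) 0<q)) (*-nonneg 0≤b (inj₁ 0<slack)))))
        refl

      -- In the scaled gap `b` is the only factor that can vanish.
      M≈N⇒b≈0 : M (4 ℕ.+ m) c₁ ≈ N (4 ℕ.+ m) c₂ → b ≈ 0#
      M≈N⇒b≈0 M≈N with 0≤b
      ... | inj₂ 0≈b = sym 0≈b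
      ... | inj₁ 0<b = ⊥-elim (<-irrefl M≈N (<-by
        (pos-*-cancelʳ (*-pos 0<X 0<Y) (<-respʳ-≈ (sym N-M-scaled)
          (*-pos (^-pos (suc m) 0<q) (*-pos 0<b 0<slack))))
        refl))

      b≈0⇒c₁≈1 : b ≈ 0# → c₁ ≈ 1#
      b≈0⇒c₁≈1 b≈0 = *-cancelʳ 0<G (begin
        c₁ * G m θ   ≈⟨ /-*-cancel X 0<G ⟩
        X            ≈⟨ trans X≈g+b (trans (+-congˡ b≈0) (+-identityʳ g)) ⟩
        g            ≈⟨ trans (*-identityˡ _) (G≈ m θ) ⟨
        1# * G m θ   ∎)
        where open SetoidReasoning setoid

      b≈0⇒c₂≈K : b ≈ 0# → c₂ ≈ K
      b≈0⇒c₂≈K b≈0 = *-cancelʳ 0<𝒢 (begin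
        c₂ * 𝒢 (suc (suc m)) θ  ≈⟨ /-*-cancel Y 0<𝒢 ⟩
        Y                       ≈⟨ trans Y≈ (+-congˡ (*-congˡ b≈0)) ⟩
        K * a + θ * 0#          ≈⟨ solve 3 (λ K a θ → K :* a :+ θ :* con (+ 0)
                                                     := K :* (a :- con (+ 0))) refl K a θ ⟩
        K * (a - 0#)            ≈⟨ *-congˡ (trans 𝒢≈a-b (+-congˡ (-‿cong b≈0))) ⟨
        K * 𝒢 (suc (suc m)) θ   ∎)
        where open SetoidReasoning setoid

-- Locating `t₂` relative to `t₁`, and the conclusion.

IsLargestZero-cong : (R : RealNumbers) → let open RealNumbers R in
  {f g : ℝ → ℝ} {z : ℝ} → (∀ x → f x ≈ g x) → IsLargestZero f z → IsLargestZero g z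
IsLargestZero-cong R f≈g (fz≈0 , largest) =
  trans (sym (f≈g _)) fz≈0 , λ x gx≈0 → largest x (trans (f≈g x) gx≈0)
  where open RealNumbers R

theorem4p13 :
    (R : RealNumbers) →
    let open RealNumbers R in
    (k : ℕ) → 2 ℕ.≤ k →
    let open Polynomials R k in
    (Λ r : ℕ → ℝ) →
    (∀ j → 1 ℕ.≤ j → IsLargestZero (G j) (Λ j)) →
    (∀ j → 1 ℕ.≤ j → IsLargestZero (𝒢 j) (r j)) →
    (√k-1 : ℝ) → IsSquareRoot (fromℕ k - 1#) √k-1 →
    (θ : ℝ) → 0# < θ → θ < fromℕ 2 * √k-1 →
    (t₁ t₂ : ℕ) → 4 ℕ.≤ t₁ → 3 ℕ.≤ t₂ →
    Λ (t₁ ∸ 3) < θ → θ ≤ Λ (t₁ ∸ 2) →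
    r (t₂ ∸ 2) < θ → θ ≤ r (t₂ ∸ 1) →
    let c₁ = (- F (t₁ ∸ 2) θ) / G (t₁ ∸ 4) θ
        c₂ = (- F (t₂ ∸ 1) θ) / 𝒢 (t₂ ∸ 2) θ
    in
    (M t₁ c₁ ≤ N t₂ c₂)
    × (M t₁ c₁ ≈ N t₂ c₂ →
       ∃[ t ] (t₁ ≡ suc t) × (t₂ ≡ suc t) × (θ ≈ Λ (t ∸ 1))
              × (c₁ ≈ 1#) × (c₂ ≈ fromℕ k))
-- With `t₁` as `4 + m` and `t₂` as `3 + n` every truncated subtraction computes; `t₂` is `t₁ - 1`
-- when `n ≡ m`, and `t₁` when `n ≡ suc m`.
theorem4p13 R k 2≤k Λ r Λ-zero r-zero √k-1 (_ , √k-1²≈k-1) θ 0<θ θ<2√k-1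
  (suc (suc (suc (suc m)))) (suc (suc (suc n))) (s≤s (s≤s (s≤s (s≤s z≤n)))) (s≤s (s≤s (s≤s z≤n)))
  Λ<θ θ≤Λ r<θ θ≤r = conclusion n≡m⊎n≡1+m
  where
  open RealNumbers R hiding (zero)
  open Polynomials R k
  open RealProperties R

  open PolynomialIdentities R k 2≤k

  module AZeros = A.LargestZeros Λ (λ j 1≤j → IsLargestZero-cong R (G≈ j) (Λ-zero j 1≤j))
  module BZeros = B.LargestZeros r (λ j 1≤j → IsLargestZero-cong R (𝒢≈ j) (r-zero j 1≤j))

  -- With `w` for `√k-1`, the square of `w - 1#` gives `2 w ≤ w * w + 1#`, and the right side is
  -- `k`.
  θ<k : θ < fromℕ k
  θ<k = <-by (+-pos-nonneg (x<y⇒0<y-x θ<2√k-1) (square-nonneg (√k-1 - 1#)))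
    (trans (solve 3 (λ K θ w →
              ((con (+ 1) :+ (con (+ 1) :+ con (+ 0))) :* w :- θ)
                :+ (w :- con (+ 1)) :* (w :- con (+ 1))
              := (w :* w :+ con (+ 1)) :- θ) refl (fromℕ k) θ √k-1)
      (+-congʳ (trans (+-congʳ √k-1²≈k-1)
        (solve 1 (λ K → (K :- con (+ 1)) :+ con (+ 1) := K) refl (fromℕ k)))))

  A>0 : A.AllPositive (suc m) θ
  A>0 = AZeros.right-of-Z m Λ<θ
  B>0 : B.AllPositive (suc n) θ
  B>0 = BZeros.right-of-Z n r<θ
  A≤0 : A.P (2 ℕ.+ m) θ ≤ 0#
  A≤0 = AZeros.P≤0-left-of-Z (suc m) A>0 θ≤Λ
  B≤0 : B.P (2 ℕ.+ n) θ ≤ 0#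
  B≤0 = BZeros.P≤0-left-of-Z (suc n) B>0 θ≤r

  0<a : 0# < A.P (suc m) θ
  0<a = A.0<P-last (suc m) A>0
  0<g : 0# < A.P m θ
  0<g = A.0<P-last m (proj₁ A>0)

  open Comparison.AtIndex R k 2≤k m 0<θ θ<k 0<g 0<a A≤0

  -- Otherwise `𝒢 (2 + n)` is a sum of two terms of `G` with index at most `suc m`, both positive at
  -- `θ`, against `B≤0`.
  n≮m : ¬ n ℕ.< m
  n≮m n<m = <⇒≱ (<-respʳ-≈ (sym (BP≈ (suc n) θ))
    (+-pos (A.AllPositive⇒0<P (s≤s n<m) A>0)
           (A.AllPositive⇒0<P (s≤s (ℕₚ.<⇒≤ n<m)) A>0)))
    B≤0

  -- Otherwise `𝒢 (3 + m)` is positive at `θ`, whereas it equals `- (θ * b + b + q * a)`.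
  n≯1+m : ¬ suc m ℕ.< n
  n≯1+m 1+m<n = pos⇒≉0
    (+-pos-nonneg (B.AllPositive⇒0<P (s≤s 1+m<n) B>0)
      (+-nonneg (+-nonneg (*-nonneg (inj₁ 0<θ) 0≤b) 0≤b) (inj₁ (*-pos 0<q 0<a))))
    (trans (+-congʳ (BP≈ (2 ℕ.+ m) θ))
      (solve 4 (λ θ d q a → ((θ :* d :- q :* a) :+ d) :+ ((θ :* :- d :+ :- d) :+ q :* a)
                  := con (+ 0)) refl θ (A.P (2 ℕ.+ m) θ) q a))

  n≡m⊎n≡1+m : n ≡ m ⊎ n ≡ suc m
  n≡m⊎n≡1+m with ℕₚ.<-cmp n m
  ... | tri< n<m _ _ = ⊥-elim (n≮m n<m)
  ... | tri≈ _ n≡m _ = inj₁ n≡m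
  ... | tri> _ _ m<n with ℕₚ.m≤n⇒m<n∨m≡n m<n
  ...   | inj₁ 1+m<n = ⊥-elim (n≯1+m 1+m<n)
  ...   | inj₂ 1+m≡n = inj₂ (≡.sym 1+m≡n)

  b≈0⇒θ≈Λ : b ≈ 0# → θ ≤ Λ (2 ℕ.+ m) → θ ≈ Λ (2 ℕ.+ m)
  b≈0⇒θ≈Λ b≈0 (inj₂ θ≈Λ) = θ≈Λ
  b≈0⇒θ≈Λ b≈0 (inj₁ θ<Λ) = ⊥-elim (pos⇒≉0 (x<y⇒0<y-x (AZeros.left-of-Z (suc m) A>0 θ<Λ))
    (trans (+-identityˡ b) b≈0))

  -- Stated for a variable index so that `subst` can replace `n` by `m` or `suc m`.
  Conclusion : ℕ → Set
  Conclusion n =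
    let c₂ = (- F (2 ℕ.+ n) θ) / 𝒢 (suc n) θ in
    (M (4 ℕ.+ m) c₁ ≤ N (3 ℕ.+ n) c₂)
    × (M (4 ℕ.+ m) c₁ ≈ N (3 ℕ.+ n) c₂ →
       ∃[ t ] (4 ℕ.+ m ≡ suc t) × (3 ℕ.+ n ≡ suc t) × (θ ≈ Λ (t ∸ 1))
              × (c₁ ≈ 1#) × (c₂ ≈ fromℕ k))

  conclusion : n ≡ m ⊎ n ≡ suc m → Conclusion n
  conclusion (inj₁ n≡m) = ≡.subst Conclusion (≡.sym n≡m)
    (inj₁ M<N , λ M≈N → ⊥-elim (<-irrefl M≈N M<N))
  conclusion (inj₂ n≡1+m) = ≡.subst Conclusion (≡.sym n≡1+m)
    (M≤N 0<BP , λ M≈N →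
      let b≈0 = M≈N⇒b≈0 0<BP M≈N in
      -- Both `t₁` and `t₂` are `4 + m` here, so `t` is `3 + m` and `t ∸ 1` is the index `2 + m` of
      -- the upper endpoint for `θ`.
      3 ℕ.+ m , ≡.refl , ≡.refl , b≈0⇒θ≈Λ b≈0 θ≤Λ , b≈0⇒c₁≈1 0<BP b≈0 , b≈0⇒c₂≈K 0<BP b≈0)
    where
    0<BP : 0# < B.P (2 ℕ.+ m) θ
    0<BP = ≡.subst (λ i → 0# < B.P (suc i) θ) n≡1+m (B.0<P-last (suc n) B>0)
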